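{- Let $n\ge 2$ and let $C_n$ be the simple directed cycle with vertices $v_0,v_1,\dots,v_{n-1}$ and with edges directed from $v_{i+1}$ to $v_i$ for all $0\le i\le n-1$ (indices modulo $n$). The possible periods of parallel chip-firing games on $C_n$ are exactly the positive divisors of $n$; that is, for a positive integer $T$, there exists a parallel chip-firing game on $C_n$ with period $T$ if and only if $T\mid n$.
   Context: A directed graph $D=(V,E)$ is a finite set of vertices $V$ with a set $E$ of ordered pairs of vertices; $(u,v)\in E$ is an edge directed from $u$ to $v$, and the out-degree $\deg^+ v$ is the number of edges directed from $v$. A parallel chip-firing game on $D$ starts with a finite nonnegative integer number of chips on each vertex. In each round, simultaneously, every vertex $v$ having at least $\deg^+ v$ chips fires, sending one chip along each of its outgoing edges; all other vertices wait. The game has period $T$ if $T$ is the smallest positive integer for which there is a round $t_0$ such that every vertex has the same number of chips in round $t$ as in round $t+T$ for all $t\ge t_0$. -}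

module Defs where

open import Data.Bool.Base using (if_then_else_)
open import Data.Fin.Base using (Fin; toℕ)
open import Data.Fin.Properties using (_≟_)
open import Data.Nat.Base using (ℕ; suc; _+_; _∸_; _≤_; _<_; NonZero)
open import Data.Nat.DivMod using (_mod_)
open import Data.Nat.GeneralisedArithmetic using (fold)
open import Data.Nat.Properties using (_≤?_)
open import Data.Product.Base using (∃-syntax; _×_)
open import Data.Vec.Base using (allFin; count)
open import Data.Vec.Functional using (Vector)
open import Level using (0ℓ)
open import Relation.Binary.Core using (Rel)
open import Relation.Binary.Definitions using (Decidable)
open import Relation.Binary.PropositionalEquality using (_≡_; _≗_)
open import Relation.Nullary.Decidable using (does; _×-dec_)

-- The edges form a relation, so there are no parallel edges; decidability is
-- automatic classically for a set of pairs of vertices.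
record Digraph (n : ℕ) : Set₁ where
  field
    Edge  : Rel (Fin n) 0ℓ
    edge? : Decidable Edge

  deg⁺ : Fin n → ℕ
  deg⁺ v = count (edge? v) (allFin n)

Chips : ℕ → Set
Chips n = Vector ℕ n

module _ {n : ℕ} (D : Digraph n) where
  open Digraph D

  Fires : Chips n → Fin n → Set
  Fires c v = deg⁺ v ≤ c v

  fires? : Decidable Fires
  fires? c v = deg⁺ v ≤? c v

  sent : Chips n → Fin n → ℕ
  sent c v = if does (fires? c v) then deg⁺ v else 0

  received : Chips n → Fin n → ℕ
  received c v = count (λ u → edge? u v ×-dec fires? c u) (allFin n)

  -- The truncated subtraction never truncates: sent c v ≤ c v.
  step : Chips n → Chips n
  step c v = (c v ∸ sent c v) + received c v

  -- The number of chips on each vertex in round t, round 0 being the start.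
  game : Chips n → ℕ → Chips n
  game c₀ t = fold c₀ step t

  EventuallyRepeats : Chips n → ℕ → Set
  EventuallyRepeats c₀ T =
    ∃[ t₀ ] (∀ t → t₀ ≤ t → game c₀ t ≗ game c₀ (t + T))

  HasPeriod : Chips n → ℕ → Set
  HasPeriod c₀ T =
    0 < T ×
    EventuallyRepeats c₀ T ×
    (∀ S → 0 < S → EventuallyRepeats c₀ S → T ≤ S)

-- The edges are those from vertex i + 1 (mod n) to vertex i.
directedCycle : (n : ℕ) .{{_ : NonZero n}} → Digraph n
directedCycle n = record
  { Edge  = λ u w → u ≡ suc (toℕ w) mod n
  ; edge? = λ u w → u ≟ (suc (toℕ w) mod n)
  }

{-# OPTIONS --safe #-}

-- A vertex of the cycle sends its only chip to its predecessor, so one round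
-- turns c(v) into pred c(v) + min(1, c(next v)).  Call pred c(v) the excess at
-- v.  It never grows, and it drops by one when 2 ≤ c(v) and next v is empty.
-- An empty vertex moves backwards along the cycle until it meets such a v.
-- Hence, while there are both an empty vertex and one with two chips, the total
-- excess eventually drops.  In the end no vertex is empty, and the game is
-- constant, or every vertex has at most one chip, and the game rotates.
-- Either way n is an eventual period, so the least one divides n.
-- Conversely, for T ∣ n, one chip on each multiple of T gives period T.
module Submission where

open import Defs
open import Algebra.Definitions.RawMonoid using (sum)
open import Data.Bool.Base using (if_then_else_; true; false)
open import Data.Fin.Base using (Fin; zero; suc; toℕ)
open import Data.Fin.Properties
  using (any?; suc-injective; toℕ-fromℕ<; toℕ-injective; toℕ<n)
open import Data.Nat.Base
  using (ℕ; zero; suc; pred; _+_; _∸_; _*_; _⊓_; _≤_; _<_; z≤n; s≤s; s≤s⁻¹;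
         NonZero; >-nonZero; +-0-rawMonoid)
open import Data.Nat.Divisibility
  using (_∣_; _∣?_; ∣⇒≤; ∣-refl; ∣m∣n⇒∣m+n; ∣m+n∣m⇒∣n; n∣m*n; %-presˡ-∣;
         ∣n∣m%n⇒∣m; m%n≡0⇒n∣m)
open import Data.Nat.DivMod
  using (_/_; _%_; _mod_; m≡m%n+[m/n]*n; m%n<n; m%n≤m; m<n⇒m%n≡m; m%n%n≡m%n;
         %-distribˡ-+; [m+n]%n≡m%n)
open import Data.Nat.GeneralisedArithmetic using (fold; fold-+)
open import Data.Nat.Induction using (<-wellFounded)
open import Data.Nat.Properties hiding (suc-injective)
open import Data.Product.Base using (∃-syntax; _×_; _,_)
open import Data.Vec.Base using (count; tabulate)
open import Function.Base using (_∘_; id)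
open import Function.Bundles using (_⇔_; mk⇔)
open import Induction.WellFounded using (Acc; acc)
open import Level using (Level)
open import Relation.Binary.PropositionalEquality
open import Relation.Nullary using (¬_; yes; no; contradiction)
open import Relation.Nullary.Decidable using (_×-dec_; does; does-⇔; dec-true)
open import Relation.Unary using (Pred; Decidable)

private
  variable
    a p : Level
    A : Set a
    n : ℕ

-- Sums and counts over the vertices

∑ : Chips n → ℕ
∑ = sum +-0-rawMonoid

∑-mono-≤ : {c d : Chips n} → (∀ v → c v ≤ d v) → ∑ c ≤ ∑ d
∑-mono-≤ {zero}  c≤d = z≤n
∑-mono-≤ {suc n} c≤d = +-mono-≤ (c≤d zero) (∑-mono-≤ (c≤d ∘ suc))

∑-mono-< : {c d : Chips n} → (∀ v → c v ≤ d v) → ∀ v → c v < d v → ∑ c < ∑ d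
∑-mono-< c≤d zero    c<d = +-mono-<-≤ c<d (∑-mono-≤ (c≤d ∘ suc))
∑-mono-< c≤d (suc v) c<d = +-mono-≤-< (c≤d zero) (∑-mono-< (c≤d ∘ suc) v c<d)

module _ {P : Pred A p} (P? : Decidable P) where

  -- Arbitrary `f` lets the induction pass to `f ∘ suc`; the counts over `allFin` are the case
  -- `f = id`.
  count-none : (f : Fin n → A) → (∀ i → ¬ P (f i)) → count P? (tabulate f) ≡ 0
  count-none {n = zero}  f none = refl
  count-none {n = suc n} f none with P? (f zero)
  ... | yes p = contradiction p (none zero)
  ... | no  _ = count-none (f ∘ suc) (none ∘ suc)

  count-one : (f : Fin n → A) (i : Fin n) → P (f i) →
              (∀ j → P (f j) → j ≡ i) → count P? (tabulate f) ≡ 1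
  count-one f zero    pi unique with P? (f zero)
  ... | yes _ = cong suc (count-none (f ∘ suc) λ j pj →
    contradiction (unique (suc j) pj) λ ())
  ... | no ¬p = contradiction pi ¬p
  count-one f (suc i) pi unique with P? (f zero)
  ... | yes p₀ with () ← unique zero p₀
  ... | no  _  = count-one (f ∘ suc) i pi (λ j → suc-injective ∘ unique (suc j))

-- Eventual periods on an arbitrary digraph

module _ (D : Digraph n) where

  game-step : ∀ c t → game D (step D c) t ≡ game D c (suc t)
  game-step c t = trans (sym (fold-+ c (step D) t)) (cong (game D c) (+-comm t 1))

  -- Starting from round `k` only renumbers the rounds, so the threshold moves from `t₀` to
  -- `t₀ + k`. This lets a game be replaced by a later stage of itself.
  repeats-game : ∀ c T k → EventuallyRepeats D (game D c k) T → EventuallyRepeats D c T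
  repeats-game c T k (t₀ , rep) = t₀ + k , λ t t₀+k≤t v → begin
    game D c t v                  ≡⟨ cong (λ s → game D c s v) (m∸n+n≡m (k≤t t t₀+k≤t)) ⟨
    game D c (t ∸ k + k) v        ≡⟨ cong (λ d → d v) (fold-+ c (step D) (t ∸ k)) ⟩
    game D (game D c k) (t ∸ k) v ≡⟨ rep (t ∸ k) (m+n≤o⇒m≤o∸n t₀ t₀+k≤t) v ⟩
    game D (game D c k) (t ∸ k + T) v
      ≡⟨ cong (λ d → d v) (fold-+ c (step D) (t ∸ k + T)) ⟨
    game D c (t ∸ k + T + k) v    ≡⟨ cong (λ s → game D c s v) (shift t t₀+k≤t) ⟩
    game D c (t + T) v            ∎
    where
    open ≡-Reasoning
    k≤t : ∀ t → t₀ + k ≤ t → k ≤ t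
    k≤t t = m+n≤o⇒n≤o t₀
    shift : ∀ t → t₀ + k ≤ t → t ∸ k + T + k ≡ t + T
    shift t le = begin
      t ∸ k + T + k   ≡⟨ +-assoc (t ∸ k) T k ⟩
      t ∸ k + (T + k) ≡⟨ cong (t ∸ k +_) (+-comm T k) ⟩
      t ∸ k + (k + T) ≡⟨ +-assoc (t ∸ k) k T ⟨
      t ∸ k + k + T   ≡⟨ cong (_+ T) (m∸n+n≡m (k≤t t le)) ⟩
      t + T           ∎

  -- Late enough, round `t` agrees with round `t + m`, which is `m / T` full periods `T` after round
  -- `t + m % T`. The threshold `t₁ + t₂` is late enough for both periods.
  repeats-% : ∀ c T .{{_ : NonZero T}} m →
              EventuallyRepeats D c T → EventuallyRepeats D c m →
              EventuallyRepeats D c (m % T)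
  repeats-% c T m (t₁ , rep₁) (t₂ , rep₂) = t₁ + t₂ , λ t le v → begin
    game D c t v                         ≡⟨ rep₂ t (m+n≤o⇒n≤o t₁ le) v ⟩
    game D c (t + m) v
      ≡⟨ cong (λ s → game D c (t + s) v) (m≡m%n+[m/n]*n m T) ⟩
    game D c (t + (m % T + m / T * T)) v
      ≡⟨ cong (λ s → game D c s v) (+-assoc t (m % T) _) ⟨
    game D c (t + m % T + m / T * T) v
      ≡⟨ multiple (m / T) _ (m≤n⇒m≤n+o (m % T) (m+n≤o⇒m≤o t₁ le)) v ⟨
    game D c (t + m % T) v               ∎
    where
    open ≡-Reasoning
    multiple : ∀ q t → t₁ ≤ t → game D c t ≗ game D c (t + q * T)
    multiple zero    t le v = cong (λ s → game D c s v) (sym (+-identityʳ t))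
    multiple (suc q) t le v = begin
      game D c t v               ≡⟨ rep₁ t le v ⟩
      game D c (t + T) v         ≡⟨ multiple q (t + T) (m≤n⇒m≤n+o T le) v ⟩
      game D c (t + T + q * T) v ≡⟨ cong (λ s → game D c s v) (+-assoc t T _) ⟩
      game D c (t + (T + q * T)) v ∎

  -- A nonzero remainder `m % T` would be an eventual period below the least one.
  period-∣ : ∀ c T m → HasPeriod D c T → EventuallyRepeats D c m → T ∣ m
  period-∣ c T@(suc _) m (_ , repT , least) repm with m % T in eq
  ... | zero  = m%n≡0⇒n∣m m T eq
  ... | suc r = contradiction
    (least (m % T) (subst (0 <_) (sym eq) (s≤s z≤n)) (repeats-% c T m repT repm))
    (<⇒≱ (m%n<n m T))

-- Successor arithmetic on the cycle

module _ (n : ℕ) .{{_ : NonZero n}} where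

  private
    C : Digraph n
    C = directedCycle n

  next : Fin n → Fin n
  next v = suc (toℕ v) mod n

  toℕ-mod : ∀ m → toℕ (m mod n) ≡ m % n
  toℕ-mod m = toℕ-fromℕ< (m%n<n m n)

  mod-cong : ∀ {k m} → k % n ≡ m % n → k mod n ≡ m mod n
  mod-cong {k} {m} eq = toℕ-injective (trans (toℕ-mod k) (trans eq (sym (toℕ-mod m))))

  toℕ-mod-inverse : ∀ v → toℕ v mod n ≡ v
  toℕ-mod-inverse v = toℕ-injective (trans (toℕ-mod (toℕ v)) (m<n⇒m%n≡m (toℕ<n v)))

  [m+k%n]%n≡[m+k]%n : ∀ m k → (m + k % n) % n ≡ (m + k) % n
  [m+k%n]%n≡[m+k]%n m k = begin
    (m + k % n) % n           ≡⟨ %-distribˡ-+ m (k % n) n ⟩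
    (m % n + k % n % n) % n   ≡⟨ cong (λ r → (m % n + r) % n) (m%n%n≡m%n k n) ⟩
    (m % n + k % n) % n       ≡⟨ %-distribˡ-+ m k n ⟨
    (m + k) % n               ∎
    where open ≡-Reasoning

  next-mod : ∀ m → next (m mod n) ≡ suc m mod n
  next-mod m = mod-cong (trans (cong (λ k → suc k % n) (toℕ-mod m)) ([m+k%n]%n≡[m+k]%n 1 m))

  next^ : Fin n → ℕ → Fin n
  next^ v = fold v next

  next^-mod : ∀ v k → next^ v k ≡ (k + toℕ v) mod n
  next^-mod v zero    = sym (toℕ-mod-inverse v)
  next^-mod v (suc k) = trans (cong next (next^-mod v k)) (next-mod (k + toℕ v))

  next^-next : ∀ v k → next^ (next v) k ≡ next (next^ v k)
  next^-next v k = trans (sym (fold-+ v next k)) (cong (next^ v) (+-comm k 1))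

  next^n≡id : ∀ v → next^ v n ≡ v
  next^n≡id v = begin
    next^ v n         ≡⟨ next^-mod v n ⟩
    (n + toℕ v) mod n ≡⟨ mod-cong (trans (cong (_% n) (+-comm n (toℕ v))) ([m+n]%n≡m%n (toℕ v) n)) ⟩
    toℕ v mod n       ≡⟨ toℕ-mod-inverse v ⟩
    v                 ∎
    where open ≡-Reasoning

  -- Going round the cycle in `n` steps is the identity, so `pred n` steps lead to the predecessor.
  next-surjective : ∀ v → next (next^ v (pred n)) ≡ v
  next-surjective v = trans (cong (next^ v) (suc-pred n)) (next^n≡id v)

  next-injective : ∀ {v w} → next v ≡ next w → v ≡ w
  next-injective {v} {w} eq = begin
    v                       ≡⟨ next-surjective v ⟨
    next (next^ v (pred n)) ≡⟨ next^-next v (pred n) ⟨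
    next^ (next v) (pred n) ≡⟨ cong (λ u → next^ u (pred n)) eq ⟩
    next^ (next w) (pred n) ≡⟨ next^-next w (pred n) ⟩
    next (next^ w (pred n)) ≡⟨ next-surjective w ⟩
    w                       ∎
    where open ≡-Reasoning

  reachable : ∀ v w → ∃[ k ] next^ v (suc k) ≡ w
  -- From `v`, `suc (pred n ∸ toℕ v)` steps lead to vertex 0, and `toℕ w` more lead to `w`.
  reachable v w = pred n ∸ toℕ v + toℕ w , (begin
    next^ v (suc (pred n ∸ toℕ v + toℕ w))       ≡⟨ next^-mod v _ ⟩
    suc (pred n ∸ toℕ v + toℕ w + toℕ v) mod n   ≡⟨ cong (λ s → suc s mod n) total ⟩
    suc (toℕ w + pred n) mod n                   ≡⟨ cong (_mod n) (+-suc (toℕ w) (pred n)) ⟨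
    (toℕ w + suc (pred n)) mod n                 ≡⟨ cong (λ s → (toℕ w + s) mod n) (suc-pred n) ⟩
    (toℕ w + n) mod n                            ≡⟨ mod-cong ([m+n]%n≡m%n (toℕ w) n) ⟩
    toℕ w mod n                                  ≡⟨ toℕ-mod-inverse w ⟩
    w                                            ∎)
    where
    open ≡-Reasoning
    total : pred n ∸ toℕ v + toℕ w + toℕ v ≡ toℕ w + pred n
    total = begin
      pred n ∸ toℕ v + toℕ w + toℕ v   ≡⟨ cong (_+ toℕ v) (+-comm (pred n ∸ toℕ v) (toℕ w)) ⟩
      toℕ w + (pred n ∸ toℕ v) + toℕ v ≡⟨ +-assoc (toℕ w) _ _ ⟩
      toℕ w + (pred n ∸ toℕ v + toℕ v) ≡⟨ cong (toℕ w +_) (m∸n+n≡m (<⇒≤pred (toℕ<n v))) ⟩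
      toℕ w + pred n                   ∎

  -- One round on the cycle

  deg⁺≡1 : ∀ v → Digraph.deg⁺ C v ≡ 1
  -- Edges run from `next w` to `w`, so the one out-neighbour of `v` is its predecessor.
  deg⁺≡1 v = count-one (Digraph.edge? C v) id (next^ v (pred n)) (sym (next-surjective v))
    λ w v≡next[w] → next-injective (trans (sym v≡next[w]) (sym (next-surjective v)))

  sends? : ∀ c v → Decidable (λ u → Digraph.Edge C u v × Fires C c u)
  sends? c v u = Digraph.edge? C u v ×-dec fires? C c u

  -- The only in-neighbour of `v` is `next v`, which, having out-degree one, fires exactly when it
  -- is nonempty.
  received≡ : ∀ c v → received C c v ≡ 1 ⊓ c (next v)
  received≡ c v with c (next v) in eq
  ... | zero  = count-none (sends? c v) id λ { u (refl , fires) →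
    contradiction (subst₂ _≤_ (deg⁺≡1 u) eq fires) λ () }
  ... | suc m = count-one (sends? c v) id (next v)
    (refl , subst₂ _≤_ (sym (deg⁺≡1 (next v))) (sym eq) (s≤s z≤n)) λ { u (u≡ , _) → u≡ }

  -- A nonempty vertex loses one chip; an empty one waits, which `pred 0 = 0` accounts for.
  step≡ : ∀ c v → step C c v ≡ pred (c v) + 1 ⊓ c (next v)
  step≡ c v = cong₂ _+_ (kept (Digraph.deg⁺ C v) (c v) (deg⁺≡1 v)) (received≡ c v)
    where
    kept : ∀ d m → d ≡ 1 → m ∸ (if does (d ≤? m) then d else 0) ≡ pred m
    kept _ zero    refl = refl
    kept _ (suc m) refl = refl

  -- The two limiting regimes

  game-fixed : ∀ {c} → (∀ v → 1 ≤ c v) → ∀ t → game C c t ≗ c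
  game-fixed         1≤c zero    v = refl
  game-fixed {c = c} 1≤c (suc t) v = begin
    step C (game C c t) v                           ≡⟨ step≡ (game C c t) v ⟩
    pred (game C c t v) + 1 ⊓ game C c t (next v)
      ≡⟨ cong₂ (λ x y → pred x + 1 ⊓ y) (game-fixed 1≤c t v) (game-fixed 1≤c t (next v)) ⟩
    pred (c v) + 1 ⊓ c (next v)                     ≡⟨ cong (pred (c v) +_) (m≤n⇒m⊓n≡m (1≤c (next v))) ⟩
    pred (c v) + 1                                  ≡⟨ +-comm (pred (c v)) 1 ⟩
    suc (pred (c v))                                ≡⟨ suc-pred (c v) {{>-nonZero (1≤c v)}} ⟩
    c v                                             ∎
    where open ≡-Reasoning

  -- A vertex with at most one chip keeps nothing, so after each round it holds exactly what
  -- `next v` held before.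
  game-rotates : ∀ {c} → (∀ v → c v ≤ 1) → ∀ t v → game C c t v ≡ c (next^ v t)
  game-rotates         c≤1 zero    v = refl
  game-rotates {c = c} c≤1 (suc t) v = begin
    step C (game C c t) v                           ≡⟨ step≡ (game C c t) v ⟩
    pred (game C c t v) + 1 ⊓ game C c t (next v)
      ≡⟨ cong₂ (λ x y → pred x + 1 ⊓ y) (game-rotates c≤1 t v) (game-rotates c≤1 t (next v)) ⟩
    pred (c (next^ v t)) + 1 ⊓ c (next^ (next v) t)
      ≡⟨ cong₂ _+_ (n≤0⇒n≡0 (pred-mono-≤ (c≤1 _))) (m≥n⇒m⊓n≡n (c≤1 _)) ⟩
    c (next^ (next v) t)                            ≡⟨ cong c (next^-next v t) ⟩
    c (next^ v (suc t))                             ∎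
    where open ≡-Reasoning

  -- Decrease of the excess

  excess : Chips n → ℕ
  excess c = ∑ (pred ∘ c)

  excess-step-≤ : ∀ c v → pred (step C c v) ≤ pred (c v)
  excess-step-≤ c v = begin
    pred (step C c v)                  ≡⟨ cong pred (step≡ c v) ⟩
    pred (pred (c v) + 1 ⊓ c (next v)) ≤⟨ pred-mono-≤ (+-monoʳ-≤ (pred (c v)) (m⊓n≤m 1 _)) ⟩
    pred (pred (c v) + 1)              ≡⟨ cong pred (+-comm (pred (c v)) 1) ⟩
    pred (c v)                         ∎
    where open ≤-Reasoning

  excess-step-< : ∀ c v → 2 ≤ c v → c (next v) ≡ 0 → excess (step C c) < excess c
  excess-step-< c v 2≤cv empty = ∑-mono-< (excess-step-≤ c) v (begin-strict
    pred (step C c v)                  ≡⟨ cong pred (step≡ c v) ⟩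
    pred (pred (c v) + 1 ⊓ c (next v)) ≡⟨ cong (λ x → pred (pred (c v) + 1 ⊓ x)) empty ⟩
    pred (pred (c v) + 0)              ≡⟨ cong pred (+-identityʳ (pred (c v))) ⟩
    -- Since `2 ≤ c v`, the number `pred (c v)` is positive and its predecessor is strictly smaller.
    pred (pred (c v))                  <⟨ ≤-reflexive (suc-pred (pred (c v)) {{>-nonZero (pred-mono-≤ 2≤cv)}}) ⟩
    pred (c v)                         ∎)
    where open ≤-Reasoning

  -- Induction on the distance from the tall vertex `v` to an empty one. If `next v` is empty, or
  -- the vertex `u` just before the empty one is tall, the excess drops at once. Otherwise `v`
  -- receives a chip and stays tall, while `u` loses any chip it has and receives none, so an empty
  -- vertex is now one step nearer.
  excess-decreases : ∀ k c v → 2 ≤ c v → c (next^ v (suc k)) ≡ 0 →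
                     ∃[ t ] excess (game C c t) < excess c
  excess-decreases zero    c v 2≤cv empty = 1 , excess-step-< c v 2≤cv empty
  excess-decreases (suc k) c v 2≤cv empty
    with c (next v) in next-empty | 2 ≤? c (next^ v (suc k))
  ... | zero  | _         = 1 , excess-step-< c v 2≤cv next-empty
  ... | suc m | yes 2≤cu  = 1 , excess-step-< c (next^ v (suc k)) 2≤cu empty
  ... | suc m | no ¬2≤cu =
    let t , lt = excess-decreases k (step C c) v 2≤step step-empty
    -- The extra first round does not raise the excess, so a drop below that of `step C c` is one
    -- below that of `c`.
    in suc t , <-≤-trans (subst (λ d → excess d < excess (step C c)) (game-step C c t) lt)
                         (∑-mono-≤ (excess-step-≤ c))
    where
    u : Fin n
    u = next^ v (suc k)
    2≤step : 2 ≤ step C c v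
    2≤step = begin
      2                           ≤⟨ +-monoˡ-≤ 1 (pred-mono-≤ 2≤cv) ⟩
      pred (c v) + 1              ≡⟨ cong (λ x → pred (c v) + 1 ⊓ x) next-empty ⟨
      pred (c v) + 1 ⊓ c (next v) ≡⟨ step≡ c v ⟨
      step C c v                  ∎
      where open ≤-Reasoning
    step-empty : step C c u ≡ 0
    step-empty = trans (step≡ c u)
      (cong₂ (λ x y → x + 1 ⊓ y) (n≤0⇒n≡0 (pred-mono-≤ (s≤s⁻¹ (≰⇒> ¬2≤cu)))) empty)

  repeats-n : ∀ c → EventuallyRepeats C c n
  repeats-n c = go c (<-wellFounded (excess c))
    where
    go : ∀ c → Acc _<_ (excess c) → EventuallyRepeats C c n
    go c (acc rec) with any? (λ v → 2 ≤? c v) | any? (λ v → c v ≟ 0)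
    ... | no ¬tall | _ = 0 , λ t _ v → begin
      game C c t v             ≡⟨ game-rotates c≤1 t v ⟩
      -- A rotation by `n` steps is inserted before the other `t`.
      c (next^ v t)            ≡⟨ cong (λ u → c (next^ u t)) (next^n≡id v) ⟨
      c (next^ (next^ v n) t)  ≡⟨ cong c (fold-+ v next t) ⟨
      c (next^ v (t + n))      ≡⟨ game-rotates c≤1 (t + n) v ⟨
      game C c (t + n) v       ∎
      where
      open ≡-Reasoning
      c≤1 : ∀ v → c v ≤ 1
      c≤1 v = s≤s⁻¹ (≰⇒> λ 2≤cv → ¬tall (v , 2≤cv))
    ... | yes _ | no ¬empty = 0 , λ t _ v →
      trans (game-fixed 1≤c t v) (sym (game-fixed 1≤c (t + n) v))
      where
      1≤c : ∀ v → 1 ≤ c v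
      1≤c v = n≢0⇒n>0 λ cv≡0 → ¬empty (v , cv≡0)
    ... | yes (v , 2≤cv) | yes (w , cw≡0)
      with k , reach ← reachable v w
      with t , lt ← excess-decreases k c v 2≤cv (trans (cong c reach) cw≡0)
      = repeats-game C c n t (go (game C c t) (rec lt))

  -- A game with period `T` for each divisor `T`

  module _ (T : ℕ) (T∣n : T ∣ n) where

    -- Defined on all of `ℕ`, so that it can be evaluated at `t + toℕ v` without wrapping round the
    -- cycle.
    indicator : ℕ → ℕ
    indicator m = if does (T ∣? m) then 1 else 0

    indicator-≤1 : ∀ m → indicator m ≤ 1
    indicator-≤1 m with does (T ∣? m)
    ... | true  = s≤s z≤n
    ... | false = z≤n

    indicator-cong : ∀ {k m} → T ∣ k ⇔ T ∣ m → indicator k ≡ indicator m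
    indicator-cong k⇔m = cong (λ b → if b then 1 else 0) (does-⇔ k⇔m (T ∣? _) (T ∣? _))

    indicator≡1⇒∣ : ∀ m → indicator m ≡ 1 → T ∣ m
    indicator≡1⇒∣ m eq with T ∣? m
    ... | yes T∣m = T∣m
    ... | no  _ with () ← eq

    ∣⇒indicator≡1 : ∀ {m} → T ∣ m → indicator m ≡ 1
    ∣⇒indicator≡1 {m} T∣m = cong (λ b → if b then 1 else 0) (dec-true (T ∣? m) T∣m)

    multiples : Chips n
    multiples v = indicator (toℕ v)

    -- The position rotates, and because `T ∣ n`, reduction modulo `n` does not affect divisibility
    -- by `T`.
    game-multiples : ∀ t v → game C multiples t v ≡ indicator (t + toℕ v)
    game-multiples t v = begin
      game C multiples t v               ≡⟨ game-rotates (indicator-≤1 ∘ toℕ) t v ⟩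
      multiples (next^ v t)              ≡⟨ cong multiples (next^-mod v t) ⟩
      indicator (toℕ ((t + toℕ v) mod n)) ≡⟨ cong indicator (toℕ-mod (t + toℕ v)) ⟩
      indicator ((t + toℕ v) % n)
        ≡⟨ indicator-cong (mk⇔ (∣n∣m%n⇒∣m T∣n) (λ T∣m → %-presˡ-∣ T∣m T∣n)) ⟩
      indicator (t + toℕ v)              ∎
      where open ≡-Reasoning

    multiples-repeats : EventuallyRepeats C multiples T
    multiples-repeats = 0 , λ t _ v → begin
      game C multiples t v        ≡⟨ game-multiples t v ⟩
      indicator (t + toℕ v)
        ≡⟨ indicator-cong (mk⇔ (∣m∣n⇒∣m+n ∣-refl) (λ T∣T+m → ∣m+n∣m⇒∣n T∣T+m ∣-refl)) ⟩
      indicator (T + (t + toℕ v)) ≡⟨ cong indicator (trans (sym (+-assoc T t _)) (cong (_+ toℕ v) (+-comm T t))) ⟩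
      indicator (t + T + toℕ v)   ≡⟨ game-multiples (t + T) v ⟨
      game C multiples (t + T) v  ∎
      where open ≡-Reasoning

    -- Vertex 0 holds a chip in round `s` exactly when `T ∣ s`. If a late round `t` is a multiple of
    -- `T`, then so is `t + S`, hence `S` is one too.
    multiples-least : ∀ S → 0 < T → EventuallyRepeats C multiples S → T ∣ S
    multiples-least S 0<T (t₀ , rep) = ∣m+n∣m⇒∣n (indicator≡1⇒∣ (t + S) (begin
      indicator (t + S)              ≡⟨ at-0 (t + S) ⟨
      game C multiples (t + S) v₀    ≡⟨ rep t (m≤m*n t₀ T {{>-nonZero 0<T}}) v₀ ⟨
      game C multiples t v₀          ≡⟨ at-0 t ⟩
      indicator t                    ≡⟨ ∣⇒indicator≡1 T∣t ⟩
      1                              ∎)) T∣t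
      where
      open ≡-Reasoning
      t : ℕ
      -- A multiple of `T` that is at least `t₀`, as `T` is positive.
      t = t₀ * T
      T∣t : T ∣ t
      T∣t = n∣m*n t₀
      v₀ : Fin n
      v₀ = 0 mod n
      toℕ-v₀ : toℕ v₀ ≡ 0
      toℕ-v₀ = trans (toℕ-mod 0) (n≤0⇒n≡0 (m%n≤m 0 n))
      at-0 : ∀ s → game C multiples s v₀ ≡ indicator s
      at-0 s = trans (game-multiples s v₀)
        (cong indicator (trans (cong (s +_) toℕ-v₀) (+-identityʳ s)))

    multiples-period : 0 < T → HasPeriod C multiples T
    multiples-period 0<T = 0<T , multiples-repeats ,
      λ S 0<S rep → ∣⇒≤ {{>-nonZero 0<S}} (multiples-least S 0<T rep)

theorem3p5 : (n : ℕ) .{{_ : NonZero n}} → 2 ≤ n → (T : ℕ) → 0 < T →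
    (∃[ c₀ ] HasPeriod (directedCycle n) c₀ T) ⇔ (T ∣ n)
theorem3p5 n _ T 0<T = mk⇔
  (λ (c , period) → period-∣ (directedCycle n) c T n period (repeats-n n c))
  (λ T∣n → multiples n T T∣n , multiples-period n T T∣n 0<T)
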